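{- There is a total computable function $d:\mathbb{N}\to\mathbb{N}$ such that for every index $a\in\mathbb{N}$, writing $\delta_a:=d(a)$: (1) $\delta_a\in\mathbf{M} \iff \varphi_a(\delta_a)\!\downarrow=1$; (2) exactly one of the following holds: (i) $\varphi_a(\delta_a)\!\downarrow=1$; (ii) $\varphi_a(\delta_a)\!\downarrow\neq 1$; (iii) $\varphi_a(\delta_a)\!\uparrow$. Consequently no adjudicator over the standard domain is simultaneously total (T), exhaustive (E), and sound (S): case (i) refutes (S), case (ii) refutes (E), and case (iii) refutes (T).
   Context: $(\varphi_e)_{e\in\mathbb{N}}$ is a fixed standard acceptable numbering of the unary partial computable functions. $\varphi_a(x)\!\downarrow=1$ means the computation converges with value $1$; $\varphi_a(x)\!\downarrow\neq1$ means it converges with a value other than $1$; $\varphi_a(x)\!\uparrow$ means it diverges. The manifestation set is $\mathbf{M}=\{p\in\mathbb{N}:\varphi_p(0)\!\downarrow=1\}$. The standard domain is $(\mathbb{N},\mathbf{M})$. An adjudicator is an index $a$, acting through $\varphi_a$: it annuls $p$ if $\varphi_a(p)\!\downarrow=1$, exempts $p$ if $\varphi_a(p)\!\downarrow\neq1$, and is silent on $p$ if $\varphi_a(p)\!\uparrow$. Over the standard domain, $a$ is: (T) total if it is silent on no $p\in\mathbb{N}$; (E) exhaustive if it annuls every $p\in\mathbb{N}$; (S) sound if for all $p$, $\varphi_a(p)\!\downarrow=1$ implies $p\notin\mathbf{M}$. -}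

module Defs where

open import Data.Fin using (Fin)
open import Data.Nat using (ℕ; suc; _<_)
open import Data.Product using (∃-syntax; _×_)
open import Data.Sum using (_⊎_)
open import Data.Vec using (Vec; []; _∷_; lookup)
open import Data.Vec.Relation.Binary.Pointwise.Inductive using (Pointwise)
open import Function.Bundles using (_⇔_)
open import Level using (Level; 0ℓ; _⊔_)
open import Relation.Binary.PropositionalEquality using (_≢_)
open import Relation.Nullary using (¬_)
open import Relation.Unary using (Pred; _∉_)

private
  variable
    n m : ℕ

-- Partial computable functions are taken to be Kleene's μ-recursive functions;
-- `Code n` is the syntax of their n-ary definitions.
data Code : ℕ → Set where
  zer  : Code n
  succ : Code 1
  proj : Fin n → Code n
  comp : Code m → Vec (Code n) m → Code n
  prec : Code n → Code (suc (suc n)) → Code (suc n)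
  mu   : Code (suc n) → Code n

infix 4 _[_]⇓_

-- `f [ xs ]⇓ y`: the computation of f on xs converges with value y.
data _[_]⇓_ : Code n → Vec ℕ n → ℕ → Set where
  ⇓zer  : {xs : Vec ℕ n} → zer [ xs ]⇓ 0
  ⇓succ : ∀ {x} → succ [ x ∷ [] ]⇓ suc x
  ⇓proj : {i : Fin n} {xs : Vec ℕ n} → proj i [ xs ]⇓ lookup xs i
  ⇓comp : {f : Code m} {gs : Vec (Code n) m} {xs : Vec ℕ n} {ys : Vec ℕ m} {z : ℕ} →
          Pointwise (λ g y → g [ xs ]⇓ y) gs ys → f [ ys ]⇓ z →
          comp f gs [ xs ]⇓ z
  ⇓prec-zero : {f : Code n} {g : Code (suc (suc n))} {xs : Vec ℕ n} {z : ℕ} →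
          f [ xs ]⇓ z → prec f g [ 0 ∷ xs ]⇓ z
  ⇓prec-suc : {f : Code n} {g : Code (suc (suc n))} {k : ℕ} {xs : Vec ℕ n} {y z : ℕ} →
          prec f g [ k ∷ xs ]⇓ y → g [ k ∷ y ∷ xs ]⇓ z →
          prec f g [ suc k ∷ xs ]⇓ z
  -- Unbounded search requires convergence at every smaller argument.
  ⇓mu   : {f : Code (suc n)} {xs : Vec ℕ n} {k : ℕ} →
          (∀ i → i < k → ∃[ y ] f [ i ∷ xs ]⇓ suc y) → f [ k ∷ xs ]⇓ 0 →
          mu f [ xs ]⇓ k

TotalComputable : (ℕ → ℕ) → Set
TotalComputable f = ∃[ c ] ∀ x → c [ x ∷ [] ]⇓ f x

-- Acceptability is the enumeration property together with the parametrisation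
-- (s-m-n) property. Enumeration makes every φ_e a single-valued partial
-- computable function; parametrisation applied to ψ(x,y) = f(y) gives every
-- unary partial computable f an index, so this is a numbering of exactly the
-- unary partial computable functions.
record AcceptableNumbering : Set₁ where
  infix 4 φ_⟨_⟩↓≡_
  field
    -- φ e ⟨ x ⟩↓≡ y is the graph of the e-th function.
    φ_⟨_⟩↓≡_ : ℕ → ℕ → ℕ → Set
    enumeration :
      ∃[ u ] ∀ e x y → (φ e ⟨ x ⟩↓≡ y) ⇔ (u [ e ∷ x ∷ [] ]⇓ y)
    parametrisation :
      ∀ (ψ : Code 2) → ∃[ s ] TotalComputable s ×
        (∀ x y z → (φ s x ⟨ y ⟩↓≡ z) ⇔ (ψ [ x ∷ y ∷ [] ]⇓ z))

  infix 4 φ_⟨_⟩↓≢_ φ_⟨_⟩↑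

  φ_⟨_⟩↓≢_ : ℕ → ℕ → ℕ → Set
  φ e ⟨ x ⟩↓≢ v = ∃[ y ] (φ e ⟨ x ⟩↓≡ y) × y ≢ v

  φ_⟨_⟩↑ : ℕ → ℕ → Set
  φ e ⟨ x ⟩↑ = ¬ (∃[ y ] φ e ⟨ x ⟩↓≡ y)

  𝐌 : Pred ℕ 0ℓ
  𝐌 p = φ p ⟨ 0 ⟩↓≡ 1

  Annuls Exempts SilentOn : ℕ → ℕ → Set
  Annuls   a p = φ a ⟨ p ⟩↓≡ 1
  Exempts  a p = φ a ⟨ p ⟩↓≢ 1
  SilentOn a p = φ a ⟨ p ⟩↑

  Total Exhaustive Sound : ℕ → Set
  Total      a = ∀ p → ¬ SilentOn a p
  Exhaustive a = ∀ p → Annuls a p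
  Sound      a = ∀ p → φ a ⟨ p ⟩↓≡ 1 → p ∉ 𝐌

ExactlyOne : {a b c : Level} → Set a → Set b → Set c → Set (a ⊔ b ⊔ c)
ExactlyOne A B C = (A ⊎ B ⊎ C) × ¬ (A × B) × ¬ (A × C) × ¬ (B × C)

{-# OPTIONS --safe #-}
-- Kleene's recursion theorem with a parameter. Parametrisation of φ_x(x) gives s
-- with φ_{s(x)}(y) = φ_x(x), and parametrisation of φ_a(s(x)) gives v with
-- φ_{v(a)}(x) = φ_a(s(x)). For d = s ∘ v this yields
-- φ_{d(a)}(y) = φ_{v(a)}(v(a)) = φ_a(s(v(a))) = φ_a(d(a)), so d(a) is manifest
-- precisely when a annuls it.
module Submission where

open import Defs
open import Axiom.ExcludedMiddle using (ExcludedMiddle)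
open import Data.Fin using (zero; suc)
open import Data.Nat using (ℕ)
open import Data.Nat.Properties using (<-cmp)
open import Data.Product using (∃-syntax; _×_; _,_)
open import Data.Sum using (_⊎_; inj₁; inj₂)
open import Data.Vec using (Vec; []; _∷_)
open import Data.Vec.Relation.Binary.Pointwise.Inductive using (Pointwise; []; _∷_)
open import Function.Base using (_∘_)
open import Function.Bundles using (_⇔_; mk⇔; module Equivalence)
open import Function.Properties.Equivalence using () renaming (sym to ⇔-sym; trans to ⇔-trans)
open import Level using (0ℓ)
open import Relation.Binary.Definitions using (tri<; tri≈; tri>)
open import Relation.Binary.PropositionalEquality using (_≡_; refl; subst)
open import Relation.Nullary using (¬_; yes; no)
open import Relation.Unary using (_∈_)

open Equivalence using (to; from)

private
  variable
    n m : ℕ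

-- Recursion is on the code first: in the `mu` case the convergence at smaller
-- arguments is only available through a function, not as a subderivation.
⇓-deterministic : (f : Code n) {xs : Vec ℕ n} {y z : ℕ} →
  f [ xs ]⇓ y → f [ xs ]⇓ z → y ≡ z
⇓-deterministic* : (gs : Vec (Code n) m) {xs : Vec ℕ n} {ys zs : Vec ℕ m} →
  Pointwise (λ g y → g [ xs ]⇓ y) gs ys → Pointwise (λ g y → g [ xs ]⇓ y) gs zs → ys ≡ zs

⇓-deterministic zer ⇓zer ⇓zer = refl
⇓-deterministic succ ⇓succ ⇓succ = refl
⇓-deterministic (proj i) ⇓proj ⇓proj = refl
⇓-deterministic (comp f gs) (⇓comp ps p) (⇓comp qs q)
  with refl ← ⇓-deterministic* gs ps qs = ⇓-deterministic f p q
⇓-deterministic (prec f g) (⇓prec-zero p) (⇓prec-zero q) = ⇓-deterministic f p q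
⇓-deterministic (prec f g) (⇓prec-suc p p′) (⇓prec-suc q q′)
  with refl ← ⇓-deterministic (prec f g) p q = ⇓-deterministic g p′ q′
⇓-deterministic (mu f) (⇓mu {k = k} below p) (⇓mu {k = l} below′ q) with <-cmp k l
... | tri≈ _ k≡l _ = k≡l
-- The search ending at the larger argument has passed the smaller one with a successor value, where
-- the other search found 0.
... | tri< k<l _ _ with _ , r ← below′ k k<l with () ← ⇓-deterministic f p r
... | tri> _ _ l<k with _ , r ← below l l<k with () ← ⇓-deterministic f q r

⇓-deterministic* [] [] [] = refl
⇓-deterministic* (g ∷ gs) (p ∷ ps) (q ∷ qs)
  with refl ← ⇓-deterministic g p q | refl ← ⇓-deterministic* gs ps qs = refl

-- Inverting a composition yields unknown intermediate values; determinism identifies them with the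
-- given `ys`.
comp-⇔ : {f : Code m} {gs : Vec (Code n) m} {xs : Vec ℕ n} {ys : Vec ℕ m} {z : ℕ} →
  Pointwise (λ g y → g [ xs ]⇓ y) gs ys → (comp f gs [ xs ]⇓ z) ⇔ (f [ ys ]⇓ z)
comp-⇔ {f = f} {gs} {z = z} ps = mk⇔ invert (⇓comp ps)
  where
  invert : comp f gs [ _ ]⇓ z → f [ _ ]⇓ z
  invert (⇓comp qs q) = subst (λ ys → f [ ys ]⇓ z) (⇓-deterministic* gs qs ps) q

∘-totalComputable : {f g : ℕ → ℕ} →
  TotalComputable f → TotalComputable g → TotalComputable (f ∘ g)
∘-totalComputable {g = g} (c , c⇓) (b , b⇓) =
  comp c (b ∷ []) , λ x → ⇓comp (b⇓ x ∷ []) (c⇓ (g x))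

module _ (N : AcceptableNumbering) where
  open AcceptableNumbering N

  -- Single-valuedness is inherited from the universal code `u`.
  φ-deterministic : ∀ {e x y z} → φ e ⟨ x ⟩↓≡ y → φ e ⟨ x ⟩↓≡ z → y ≡ z
  φ-deterministic {e} {x} {y} {z} p q with u , enum ← enumeration =
    ⇓-deterministic u (to (enum e x y) p) (to (enum e x z) q)

  selfApplication : ∃[ d ] TotalComputable d ×
    (∀ a y z → (φ d a ⟨ y ⟩↓≡ z) ⇔ (φ a ⟨ d a ⟩↓≡ z))
  selfApplication
    with u , enum ← enumeration
    with s , (c , c⇓) , φs ← parametrisation (comp u (proj zero ∷ proj zero ∷ []))
    with v , v-computable , φv ←
      parametrisation (comp u (proj zero ∷ comp c (proj (suc zero) ∷ []) ∷ []))
    = s ∘ v , ∘-totalComputable (c , c⇓) v-computable , λ a y z →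
        -- After each parametrisation, `comp-⇔` evaluates the arguments of `u` and `enum` folds `u`
        -- back into `φ`. The diagonal point is `φv` at input `v a`, which `c` sends to `s (v a)`.
        ⇔-trans (φs (v a) y z)
          (⇔-trans (comp-⇔ (⇓proj ∷ ⇓proj ∷ []))
          (⇔-trans (⇔-sym (enum (v a) (v a) z))
          (⇔-trans (φv a (v a) z)
          (⇔-trans (comp-⇔ (⇓proj ∷ ⇓comp (⇓proj ∷ []) (c⇓ (v a)) ∷ []))
          (⇔-sym (enum a (s (v a)) z))))))

  -- Convergence is undecidable, so the case split is classical: first on annulment, then on
  -- halting.
  trichotomy : ExcludedMiddle 0ℓ → ∀ a p → Annuls a p ⊎ Exempts a p ⊎ SilentOn a p
  trichotomy em a p with em {Annuls a p} | em {∃[ y ] φ a ⟨ p ⟩↓≡ y}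
  ... | yes annuls | _ = inj₁ annuls
  ... | no ¬annuls | yes (y , q) = inj₂ (inj₁ (y , q , λ where refl → ¬annuls q))
  ... | no _ | no silent = inj₂ (inj₂ silent)

theorem3p1 : (N : AcceptableNumbering) → let open AcceptableNumbering N in
    (∃[ d ] TotalComputable d × (∀ (a : ℕ) → let δ = d a in
    (δ ∈ 𝐌 ⇔ φ a ⟨ δ ⟩↓≡ 1)
    × (ExcludedMiddle 0ℓ → ExactlyOne (φ a ⟨ δ ⟩↓≡ 1) (φ a ⟨ δ ⟩↓≢ 1) (φ a ⟨ δ ⟩↑))
    × (φ a ⟨ δ ⟩↓≡ 1 → ¬ Sound a)
    × (φ a ⟨ δ ⟩↓≢ 1 → ¬ Exhaustive a)
    × (φ a ⟨ δ ⟩↑ → ¬ Total a)))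
    × (∀ (a : ℕ) → ¬ (Total a × Exhaustive a × Sound a))
theorem3p1 N with d , d-computable , φd ← selfApplication N =
    (d , d-computable , λ a →
        -- Manifestation means value 1 on input 0, hence this instance of the fixed-point
        -- equivalence.
        φd a 0 1
      , (λ em → trichotomy N em a (d a) , (λ (p , y , q , y≢1) → y≢1 (φ-deterministic N q p))
              , (λ (p , silent) → silent (1 , p))
              , (λ ((y , q , _) , silent) → silent (y , q)))
      , (λ p sound → sound (d a) p (from (φd a 0 1) p))
      , (λ (y , q , y≢1) exhaustive → y≢1 (φ-deterministic N q (exhaustive (d a))))
      , (λ silent total → total (d a) silent))
  -- Exhaustiveness puts `d a` directly in case (i): it is annulled, hence manifest, which soundness
  -- forbids.
  , λ a (_ , exhaustive , sound) →
      sound (d a) (exhaustive (d a)) (from (φd a 0 1) (exhaustive (d a)))
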